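{- The Vámos matroid $V_8$ is freely representable over $\mathbb{Z}/8\mathbb{Z}$.
   Context: $V_8$ is the rank-4 matroid on $E=\{a,b,c,d,e,f,g,h\}$ whose circuits are the five 4-sets $\{a,b,c,d\},\{a,b,e,f\},\{c,d,e,f\},\{a,b,g,h\},\{c,d,g,h\}$ together with all 5-subsets of $E$ containing none of these. For the local ring $R=\mathbb{Z}/8\mathbb{Z}$ with maximal ideal $\mathfrak{m}=2R$, vectors $v_1,\dots,v_\ell$ are modular independent if $\sum\alpha_iv_i=0$ implies all $\alpha_i\in\mathfrak{m}$. For a $k\times|E|$ matrix $A$ over $R$, $M[A]$ is the independence system on the column index set whose independent sets are the sets of columns that are modular independent. A matroid $M$ is freely representable over $R$ if $M\cong M[A]$ for some matrix $A$ over $R$ which, after a permutation of columns, has the form $[I_k\mid P]$. -}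

module Defs where

open import Data.Nat using (ℕ; zero; suc; _<_; _≤_)
import Data.Nat as ℕ
open import Data.Nat.DivMod using (_mod_)
open import Data.Fin using (Fin; toℕ; zero; suc)
open import Data.Bool using (Bool; true; false; if_then_else_)
open import Data.Product using (Σ; ∃; _×_; _,_)
open import Data.Empty using (⊥)
open import Relation.Nullary using (¬_)
open import Relation.Binary.PropositionalEquality using (_≡_)
open import Data.Fin.Permutation using (Permutation′; _⟨$⟩ʳ_; _⟨$⟩ˡ_)
open import Function.Bundles using (_⇔_)
open import Data.Nat.Properties using (_≟_)
open import Relation.Nullary.Decidable using (⌊_⌋)

ℤ₈ : Set
ℤ₈ = Fin 8

0₈ 1₈ : ℤ₈
0₈ = zero
1₈ = suc zero

_+₈_ : ℤ₈ → ℤ₈ → ℤ₈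
a +₈ b = (toℕ a ℕ.+ toℕ b) mod 8

_*₈_ : ℤ₈ → ℤ₈ → ℤ₈
a *₈ b = (toℕ a ℕ.* toℕ b) mod 8

In𝔪 : ℤ₈ → Set
In𝔪 x = ∃ λ (y : ℤ₈) → x ≡ (toℕ y ℕ.* 2) mod 8

∑ : ∀ {n} → (Fin n → ℤ₈) → ℤ₈
∑ {zero}  f = 0₈
∑ {suc n} f = f zero +₈ ∑ (λ j → f (suc j))

Subset : ℕ → Set
Subset n = Fin n → Bool

_∈_ : ∀ {n} → Fin n → Subset n → Set
j ∈ S = S j ≡ true

_∉_ : ∀ {n} → Fin n → Subset n → Set
j ∉ S = S j ≡ false

_⊆_ : ∀ {n} → Subset n → Subset n → Set
S ⊆ T = ∀ j → j ∈ S → j ∈ T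

Matrix : ℕ → ℕ → Set
Matrix k n = Fin k → Fin n → ℤ₈

ModIndep : ∀ {k n} → Matrix k n → Subset n → Set
ModIndep {k} {n} A S =
  (α : Fin n → ℤ₈) →
  (∀ j → j ∉ S → α j ≡ 0₈) →
  (∀ i → ∑ (λ j → α j *₈ A i j) ≡ 0₈) →
  ∀ j → j ∈ S → In𝔪 (α j)

-- The Vámos matroid V₈ on E = {a,…,h} = Fin 8 (a=0, b=1, …, h=7)

E : Set
E = Fin 8

abcd abef cdef abgh cdgh : Subset 8
abcd j = ⌊ toℕ j ≟ 0 ⌋ Data.Bool.∨ ⌊ toℕ j ≟ 1 ⌋ Data.Bool.∨ ⌊ toℕ j ≟ 2 ⌋ Data.Bool.∨ ⌊ toℕ j ≟ 3 ⌋
abef j = ⌊ toℕ j ≟ 0 ⌋ Data.Bool.∨ ⌊ toℕ j ≟ 1 ⌋ Data.Bool.∨ ⌊ toℕ j ≟ 4 ⌋ Data.Bool.∨ ⌊ toℕ j ≟ 5 ⌋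
cdef j = ⌊ toℕ j ≟ 2 ⌋ Data.Bool.∨ ⌊ toℕ j ≟ 3 ⌋ Data.Bool.∨ ⌊ toℕ j ≟ 4 ⌋ Data.Bool.∨ ⌊ toℕ j ≟ 5 ⌋
abgh j = ⌊ toℕ j ≟ 0 ⌋ Data.Bool.∨ ⌊ toℕ j ≟ 1 ⌋ Data.Bool.∨ ⌊ toℕ j ≟ 6 ⌋ Data.Bool.∨ ⌊ toℕ j ≟ 7 ⌋
cdgh j = ⌊ toℕ j ≟ 2 ⌋ Data.Bool.∨ ⌊ toℕ j ≟ 3 ⌋ Data.Bool.∨ ⌊ toℕ j ≟ 6 ⌋ Data.Bool.∨ ⌊ toℕ j ≟ 7 ⌋

∣_∣ : ∀ {n} → Subset n → ℕ
∣_∣ {zero}  S = 0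
∣_∣ {suc n} S = (if S zero then 1 else 0) ℕ.+ ∣ (λ j → S (suc j)) ∣

data Special4 : Subset 8 → Set where
  c-abcd : Special4 abcd
  c-abef : Special4 abef
  c-cdef : Special4 cdef
  c-abgh : Special4 abgh
  c-cdgh : Special4 cdgh

IsSpecial4 : Subset 8 → Set
IsSpecial4 C = ∃ λ D → Special4 D × (∀ j → C j ≡ D j)

V₈-Circuit : Subset 8 → Set
V₈-Circuit C =
  IsSpecial4 C ⊎′
  (∣ C ∣ ≡ 5 × (∀ D → Special4 D → ¬ (D ⊆ C)))
  where
    open import Data.Sum using () renaming (_⊎_ to _⊎′_)

V₈-Indep : Subset 8 → Set
V₈-Indep S = ∀ C → V₈-Circuit C → ¬ (C ⊆ S)

V₈≅M[_] : ∀ {k} → Matrix k 8 → Set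
V₈≅M[ A ] = Σ (Permutation′ 8) λ σ →
  ∀ (S : Subset 8) → V₈-Indep S ⇔ ModIndep A (λ c → S (σ ⟨$⟩ˡ c))

-- After permuting columns by π, A has the form [I_k ∣ P]:
-- column π(j) is the j-th unit vector for j < k.
StandardForm : ∀ {k} → Matrix k 8 → Set
StandardForm {k} A = k ≤ 8 × Σ (Permutation′ 8) λ π →
  ∀ (i j : Fin 8) → (i< : toℕ i < k) → toℕ j < k →
  A (Data.Fin.fromℕ< i<) (π ⟨$⟩ʳ j) ≡ (if ⌊ toℕ i ≟ toℕ j ⌋ then 1₈ else 0₈)

FreelyRepresentableV₈overℤ₈ : Set
FreelyRepresentableV₈overℤ₈ =
  ∃ λ k → Σ (Matrix k 8) λ A → StandardForm A × V₈≅M[ A ]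

{-# OPTIONS --safe #-}
-- A linear relation among columns with an odd coefficient makes a set dependent.
-- Conversely, if for every j ∈ S some combination w of the rows has w_j = 4 and
-- vanishes on S ∖ {j}, then pairing w with a relation α supported on S gives
-- 4 α_j = 0, so α_j ∈ 𝔪 and S is modular independent.  (By the Smith normal form
-- over ℤ/8ℤ such w always exist when S is independent.)  An explicit 4 × 8 matrix,
-- one odd relation per circuit of V₈ and a finite list of rows w then reduce the
-- theorem to a check over the 256 subsets of E.
module Submission where

open import Defs

open import Algebra.Bundles using (CommutativeSemiring)
import Algebra.Properties.Semiring.Sum as SemiringSum
open import Algebra.Structures.Biased using (isCommutativeSemiringˡ)
open import Data.Bool using (Bool; true; false; if_then_else_)
import Data.Bool.Properties as Bool
open import Data.Fin using (Fin; zero; suc; toℕ; fromℕ<; punchIn)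
open import Data.Fin.Patterns
open import Data.Fin.Permutation using (transpose; _⟨$⟩ʳ_) renaming (id to idₚ)
open import Data.Fin.Properties using (all?; any?; punchInᵢ≢i) renaming (_≟_ to _≟ᶠ_)
open import Data.List using (List; []; _∷_)
open import Data.List.Relation.Unary.All as All using (All)
open import Data.List.Relation.Unary.Any as Any using (Any)
open import Data.Nat as ℕ using (ℕ; zero; suc; z≤n; s≤s)
open import Data.Nat.DivMod using (_mod_)
import Data.Nat.Properties as ℕ
open import Data.Product using (∃; _×_; _,_)
open import Data.Sum using (_⊎_; inj₁; inj₂; [_,_]′)
open import Data.Vec using (Vec; []; _∷_; lookup; map; tabulate)
open import Data.Vec.Properties using (lookup∘tabulate)
open import Function using (_∘_; mk⇔)
open import Relation.Binary.PropositionalEquality using (_≡_; _≢_; refl; sym; trans; cong; cong₂; subst; isEquivalence; module ≡-Reasoning)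
open import Relation.Nullary using (¬_; Dec; yes; no; contradiction)
open import Relation.Nullary.Decidable using (⌊_⌋; from-yes; map′; ¬?; _×-dec_; _⊎-dec_; _→-dec_)
open import Relation.Unary using (Decidable)

-- Arithmetic of ℤ/8ℤ, by exhaustion over its eight elements.

4₈ : ℤ₈
4₈ = 4F

+₈-assoc : ∀ a b c → (a +₈ b) +₈ c ≡ a +₈ (b +₈ c)
+₈-assoc = from-yes (all? λ a → all? λ b → all? λ c → (a +₈ b) +₈ c ≟ᶠ a +₈ (b +₈ c))

+₈-comm : ∀ a b → a +₈ b ≡ b +₈ a
+₈-comm = from-yes (all? λ a → all? λ b → a +₈ b ≟ᶠ b +₈ a)

+₈-identityˡ : ∀ a → 0₈ +₈ a ≡ a
+₈-identityˡ = from-yes (all? λ a → 0₈ +₈ a ≟ᶠ a)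

*₈-assoc : ∀ a b c → (a *₈ b) *₈ c ≡ a *₈ (b *₈ c)
*₈-assoc = from-yes (all? λ a → all? λ b → all? λ c → (a *₈ b) *₈ c ≟ᶠ a *₈ (b *₈ c))

*₈-comm : ∀ a b → a *₈ b ≡ b *₈ a
*₈-comm = from-yes (all? λ a → all? λ b → a *₈ b ≟ᶠ b *₈ a)

*₈-identityˡ : ∀ a → 1₈ *₈ a ≡ a
*₈-identityˡ = from-yes (all? λ a → 1₈ *₈ a ≟ᶠ a)

*₈-distribʳ-+₈ : ∀ a b c → (b +₈ c) *₈ a ≡ (b *₈ a) +₈ (c *₈ a)
*₈-distribʳ-+₈ = from-yes (all? λ a → all? λ b → all? λ c → (b +₈ c) *₈ a ≟ᶠ (b *₈ a) +₈ (c *₈ a))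

ℤ₈-commutativeSemiring : CommutativeSemiring _ _
ℤ₈-commutativeSemiring = record
  { isCommutativeSemiring = isCommutativeSemiringˡ record
    { +-isCommutativeMonoid = record
      { isMonoid = record
        { isSemigroup = record
          { isMagma = record { isEquivalence = isEquivalence ; ∙-cong = cong₂ _+₈_ }
          ; assoc   = +₈-assoc }
        ; identity = +₈-identityˡ , λ a → trans (+₈-comm a 0₈) (+₈-identityˡ a) }
      ; comm = +₈-comm }
    ; *-isCommutativeMonoid = record
      { isMonoid = record
        { isSemigroup = record
          { isMagma = record { isEquivalence = isEquivalence ; ∙-cong = cong₂ _*₈_ }
          ; assoc   = *₈-assoc }
        ; identity = *₈-identityˡ , λ a → trans (*₈-comm a 1₈) (*₈-identityˡ a) }
      ; comm = *₈-comm }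
    ; distribʳ = *₈-distribʳ-+₈
    ; zeroˡ    = λ _ → refl
    } }

-- Finite sums over a commutative semiring.

module _ {c ℓ} (R : CommutativeSemiring c ℓ) where
  open CommutativeSemiring R using (_≈_; _+_; _*_; 0#; semiring; setoid; +-congˡ; +-identityʳ; *-congˡ; *-commutativeSemigroup; zeroʳ)
    renaming (Carrier to K; trans to ≈-trans)
  open SemiringSum semiring
  open import Algebra.Properties.CommutativeSemigroup *-commutativeSemigroup using (x∙yz≈y∙xz)
  open import Relation.Binary.Reasoning.Setoid setoid

  sum-zero : ∀ {n} {f : Fin n → K} → (∀ i → f i ≈ 0#) → sum f ≈ 0#
  sum-zero {n} f≈0 = ≈-trans (sum-cong-≋ f≈0) (sum-replicate-zero n)

  sum-single : ∀ {n} (f : Fin n → K) j → (∀ i → i ≢ j → f i ≈ 0#) → sum f ≈ f j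
  sum-single {suc n} f j f≈0 = begin
    sum f                      ≈⟨ sum-remove {i = j} f ⟩
    f j + sum (f ∘ punchIn j)  ≈⟨ +-congˡ (sum-zero λ i → f≈0 (punchIn j i) (punchInᵢ≢i j i)) ⟩
    f j + 0#                   ≈⟨ +-identityʳ (f j) ⟩
    f j                        ∎

  -- Expanding `w` as a combination of the rows and exchanging the two sums leaves, for each row,
  -- `c i` times the sum that `α` annihilates.
  kernel⊥rowSpace : ∀ {k n} (M : Fin k → Fin n → K) {α w : Fin n → K} {c : Fin k → K} →
                    (∀ i → sum (λ j → α j * M i j) ≈ 0#) →
                    (∀ j → w j ≈ sum (λ i → c i * M i j)) →
                    sum (λ j → α j * w j) ≈ 0#
  kernel⊥rowSpace M {α} {w} {c} Mα≈0 w≈cM = begin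
    sum (λ j → α j * w j)                           ≈⟨ sum-cong-≋ (λ j → *-congˡ (w≈cM j)) ⟩
    sum (λ j → α j * sum (λ i → c i * M i j))       ≈⟨ sum-cong-≋ (λ j → *-distribˡ-sum (α j) λ i → c i * M i j) ⟩
    sum (λ j → sum λ i → α j * (c i * M i j))       ≈⟨ sum-cong-≋ (λ j → sum-cong-≋ λ i → x∙yz≈y∙xz (α j) (c i) (M i j)) ⟩
    sum (λ j → sum λ i → c i * (α j * M i j))       ≈⟨ ∑-comm (λ j i → c i * (α j * M i j)) ⟩
    sum (λ i → sum λ j → c i * (α j * M i j))       ≈⟨ sum-cong-≋ (λ i → *-distribˡ-sum (c i) λ j → α j * M i j) ⟨
    sum (λ i → c i * sum (λ j → α j * M i j))       ≈⟨ sum-zero (λ i → ≈-trans (*-congˡ (Mα≈0 i)) (zeroʳ (c i))) ⟩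
    0#                                              ∎

-- Certificates for modular independence and dependence.

open CommutativeSemiring ℤ₈-commutativeSemiring using (semiring; zeroˡ; zeroʳ)
open SemiringSum semiring using (sum)

∑≡sum : ∀ {n} (f : Fin n → ℤ₈) → ∑ f ≡ sum f
∑≡sum {zero}  f = refl
∑≡sum {suc n} f = cong (f zero +₈_) (∑≡sum (f ∘ suc))

-- The annihilator of 4 in ℤ/8ℤ is exactly 𝔪 = 2R, so membership in 𝔪 can be tested by one equation.
annihilated⇒In𝔪 : ∀ x → x *₈ 4₈ ≡ 0₈ → In𝔪 x
annihilated⇒In𝔪 = from-yes (all? λ x → (x *₈ 4₈ ≟ᶠ 0₈) →-dec any? λ (y : ℤ₈) → x ≟ᶠ (toℕ y ℕ.* 2) mod 8)

In𝔪⇒annihilated : ∀ x → In𝔪 x → x *₈ 4₈ ≡ 0₈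
In𝔪⇒annihilated _ (y , refl) = even y
  where
  even : ∀ (y : ℤ₈) → ((toℕ y ℕ.* 2) mod 8) *₈ 4₈ ≡ 0₈
  even = from-yes (all? λ (y : ℤ₈) → ((toℕ y ℕ.* 2) mod 8) *₈ 4₈ ≟ᶠ 0₈)

Relation : ∀ {k n} → Matrix k n → (Fin n → ℤ₈) → Set
Relation A α = ∀ i → ∑ (λ j → α j *₈ A i j) ≡ 0₈

InRowSpace : ∀ {k n} → Matrix k n → (Fin n → ℤ₈) → Set
InRowSpace {k} A w = ∃ λ (c : Fin k → ℤ₈) → ∀ j → w j ≡ ∑ (λ i → c i *₈ A i j)

-- The entries of `w` outside `S` are left free: relations supported on `S` have zero coefficients
-- there.
Separates : ∀ {n} → Subset n → Fin n → (Fin n → ℤ₈) → Set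
Separates S j w = w j ≡ 4₈ × (∀ i → i ∈ S → i ≢ j → w i ≡ 0₈)

separates? : ∀ {n} (S : Subset n) j → Decidable (Separates S j)
separates? S j w =
  (w j ≟ᶠ 4₈) ×-dec all? λ i → (S i Bool.≟ true) →-dec (¬? (i ≟ᶠ j) →-dec (w i ≟ᶠ 0₈))

separated⇒ModIndep : ∀ {k n} (A : Matrix k n) (S : Subset n) →
                     (∀ j → j ∈ S → ∃ λ w → InRowSpace A w × Separates S j w) → ModIndep A S
separated⇒ModIndep A S cert α α∉S≡0 rel j j∈S with cert j j∈S
... | w , (c , w≡cA) , wj≡4 , w≡0 = annihilated⇒In𝔪 (α j) (begin
  α j *₈ 4₈              ≡⟨ cong (α j *₈_) wj≡4 ⟨
  -- Every other term of the pairing vanishes: inside `S` because of `w`, outside `S` because of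
  -- `α`.
  α j *₈ w j             ≡⟨ sum-single ℤ₈-commutativeSemiring (λ i → α i *₈ w i) j term≡0 ⟨
  sum (λ i → α i *₈ w i) ≡⟨ kernel⊥rowSpace ℤ₈-commutativeSemiring A {α} {w} {c}
                             (λ i → trans (sym (∑≡sum λ j → α j *₈ A i j)) (rel i))
                             (λ j → trans (w≡cA j) (∑≡sum λ i → c i *₈ A i j)) ⟩
  0₈                     ∎)
  where
  open ≡-Reasoning
  term≡0 : ∀ i → i ≢ j → α i *₈ w i ≡ 0₈
  term≡0 i i≢j with S i in eq
  ... | true  = trans (cong (α i *₈_) (w≡0 i eq i≢j)) (zeroʳ (α i))
  ... | false = trans (cong (_*₈ w i) (α∉S≡0 i eq)) (zeroˡ (w i))

supp : ∀ {n} → (Fin n → ℤ₈) → Subset n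
supp α j with α j
... | zero  = false
... | suc _ = true

supp-false⇒≡0 : ∀ {n} (α : Fin n → ℤ₈) j → supp α j ≡ false → α j ≡ 0₈
supp-false⇒≡0 α j eq with α j
... | zero = refl

∉-⊆ : ∀ {n} {S T : Subset n} → S ⊆ T → ∀ j → j ∉ T → j ∉ S
∉-⊆ {S = S} S⊆T j j∉T with S j in eq
... | false = refl
... | true  = contradiction (trans (sym (S⊆T j eq)) j∉T) λ ()

-- A coefficient is odd, that is, a unit outside 𝔪, exactly when multiplication by 4 does not kill
-- it.
OddRelation : ∀ {k n} → Matrix k n → (Fin n → ℤ₈) → Set
OddRelation A α = Relation A α × ∃ λ j → α j *₈ 4₈ ≢ 0₈

oddRelation⇒¬ModIndep : ∀ {k n} (A : Matrix k n) {S α} →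
                        OddRelation A α → supp α ⊆ S → ¬ ModIndep A S
oddRelation⇒¬ModIndep A {S} {α} (rel , j , odd) supp⊆S indep = odd αj4≡0
  where
  α∉S≡0 : ∀ i → i ∉ S → α i ≡ 0₈
  α∉S≡0 i i∉S = supp-false⇒≡0 α i (∉-⊆ supp⊆S i i∉S)

  αj4≡0 : α j *₈ 4₈ ≡ 0₈
  αj4≡0 with S j in eq
  ... | true  = In𝔪⇒annihilated (α j) (indep α α∉S≡0 rel j eq)
  -- If `j` lies outside `S`, its coefficient is 0 and thus killed by 4, which contradicts `odd`
  -- just the same.
  ... | false = cong (_*₈ 4₈) (α∉S≡0 j eq)

-- Inclusion of subsets and heredity of independence.

≗⇒⊆ : ∀ {n} {S T : Subset n} → (∀ j → S j ≡ T j) → S ⊆ T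
≗⇒⊆ S≗T j = trans (sym (S≗T j))

⊆-trans : ∀ {n} {S T U : Subset n} → S ⊆ T → T ⊆ U → S ⊆ U
⊆-trans S⊆T T⊆U j = T⊆U j ∘ S⊆T j

_⊆?_ : ∀ {n} (S T : Subset n) → Dec (S ⊆ T)
S ⊆? T = all? λ j → (S j Bool.≟ true) →-dec (T j Bool.≟ true)

∣∣-mono-⊆ : ∀ {n} {S T : Subset n} → S ⊆ T → ∣ S ∣ ℕ.≤ ∣ T ∣
∣∣-mono-⊆ {zero}          S⊆T = z≤n
∣∣-mono-⊆ {suc n} {S} {T} S⊆T with S zero in s | T zero in t
... | false | false = ∣∣-mono-⊆ (S⊆T ∘ suc)
... | false | true  = ℕ.m≤n⇒m≤1+n (∣∣-mono-⊆ (S⊆T ∘ suc))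
... | true  | true  = s≤s (∣∣-mono-⊆ (S⊆T ∘ suc))
... | true  | false = contradiction (trans (sym (S⊆T zero s)) t) λ ()

-- A relation supported on `S` is also supported on `T`. Applied to mutual inclusions, this
-- transports independence between pointwise equal subsets without function extensionality.
ModIndep-⊆ : ∀ {k n} (A : Matrix k n) {S T : Subset n} → S ⊆ T → ModIndep A T → ModIndep A S
ModIndep-⊆ A S⊆T indep α α∉S≡0 rel j j∈S =
  indep α (λ i → α∉S≡0 i ∘ ∉-⊆ S⊆T i) rel j (S⊆T j j∈S)

V₈-Indep-⊆ : ∀ {S T} → S ⊆ T → V₈-Indep T → V₈-Indep S
V₈-Indep-⊆ S⊆T indep C circ C⊆S = indep C circ (⊆-trans C⊆S S⊆T)

-- Decision procedures for subsets and circuits.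

-- Boolean vectors stand in for subsets: they can be enumerated by constructors, whereas functions
-- `Fin n → Bool` are determined by their values only up to pointwise equality.
allVec? : ∀ {n} {P : Vec Bool n → Set} → Decidable P → Dec (∀ v → P v)
allVec? {zero}  P? = map′ (λ { p [] → p }) (λ p → p []) (P? [])
allVec? {suc n} P? =
  map′ (λ { (p , q) (true ∷ v) → p v ; (p , q) (false ∷ v) → q v })
       (λ p → (λ v → p (true ∷ v)) , (λ v → p (false ∷ v)))
       (allVec? (P? ∘ (true ∷_)) ×-dec allVec? (P? ∘ (false ∷_)))

allSpecial? : {P : Subset 8 → Set} → Decidable P → Dec (∀ D → Special4 D → P D)
allSpecial? P? =
  map′ (λ { (p , _) _ c-abcd → p
          ; (_ , p , _) _ c-abef → p
          ; (_ , _ , p , _) _ c-cdef → p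
          ; (_ , _ , _ , p , _) _ c-abgh → p
          ; (_ , _ , _ , _ , p) _ c-cdgh → p })
       (λ p → p _ c-abcd , p _ c-abef , p _ c-cdef , p _ c-abgh , p _ c-cdgh)
       (P? abcd ×-dec P? abef ×-dec P? cdef ×-dec P? abgh ×-dec P? cdgh)

anySpecial? : {P : Subset 8 → Set} → Decidable P → Dec (∃ λ D → Special4 D × P D)
anySpecial? P? =
  map′ (λ { (inj₁ p) → _ , c-abcd , p
          ; (inj₂ (inj₁ p)) → _ , c-abef , p
          ; (inj₂ (inj₂ (inj₁ p))) → _ , c-cdef , p
          ; (inj₂ (inj₂ (inj₂ (inj₁ p)))) → _ , c-abgh , p
          ; (inj₂ (inj₂ (inj₂ (inj₂ p)))) → _ , c-cdgh , p })
       (λ { (_ , c-abcd , p) → inj₁ p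
          ; (_ , c-abef , p) → inj₂ (inj₁ p)
          ; (_ , c-cdef , p) → inj₂ (inj₂ (inj₁ p))
          ; (_ , c-abgh , p) → inj₂ (inj₂ (inj₂ (inj₁ p)))
          ; (_ , c-cdgh , p) → inj₂ (inj₂ (inj₂ (inj₂ p))) })
       (P? abcd ⊎-dec P? abef ⊎-dec P? cdef ⊎-dec P? abgh ⊎-dec P? cdgh)

V₈-Circuit? : Decidable V₈-Circuit
V₈-Circuit? C =
  anySpecial? (λ D → all? λ j → C j Bool.≟ D j)
  ⊎-dec ((∣ C ∣ ℕ.≟ 5) ×-dec allSpecial? λ D → ¬? (D ⊆? C))

-- The representing matrix and the lists of certificates.

vec : (a b c d e f g h : ℕ) → E → ℤ₈
vec a b c d e f g h = lookup (map (_mod 8) (a ∷ b ∷ c ∷ d ∷ e ∷ f ∷ g ∷ h ∷ []))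

-- Found by a randomised search with unit vectors fixed in columns a, b, c, e.
A : Matrix 4 8
A 0F = vec 1 0 0 6 0 5 3 2
A 1F = vec 0 1 0 6 0 1 4 1
A 2F = vec 0 0 1 5 0 0 7 1
A 3F = vec 0 0 0 0 1 2 5 3

-- Proofs of `m < n` are all equal, so testing one suffices. The row index in `StandardForm` is
-- built from such a proof.
all<? : ∀ {m n} {P : m ℕ.< n → Set} → (∀ m<n → Dec (P m<n)) → Dec (∀ m<n → P m<n)
all<? {m} {n} {P} P? with m ℕ.<? n
... | yes m<n = map′ (λ p _ → subst P (ℕ.<-irrelevant _ _) p) (λ p → p m<n) (P? m<n)
... | no  m≮n = yes λ m<n → contradiction m<n m≮n

A-standardForm : StandardForm A
-- The unit columns are a, b, c, e; swapping d and e brings the fourth of them to position 3.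
A-standardForm = from-yes (4 ℕ.≤? 8) , transpose 3F 4F , from-yes
  (all? λ (i : E) → all? λ (j : E) → all<? λ (i< : toℕ i ℕ.< 4) → (toℕ j ℕ.<? 4) →-dec
    (A (fromℕ< i<) (transpose 3F 4F ⟨$⟩ʳ j) ≟ᶠ (if ⌊ toℕ i ℕ.≟ toℕ j ⌋ then 1₈ else 0₈)))

-- The first five supports are the special 4-sets. The other 36 are the 5-sets containing none of
-- these: of the 56 5-sets, each special set excludes 4, with no overlap.
relations : List (E → ℤ₈)
relations =
  vec 2 2 3 1 0 0 0 0 ∷
  vec 1 5 0 0 2 3 0 0 ∷
  vec 3 3 0 0 0 0 1 1 ∷
  vec 0 0 3 1 4 2 0 0 ∷
  vec 0 0 3 1 0 0 2 2 ∷
  vec 5 4 1 0 3 0 1 0 ∷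
  vec 2 1 1 0 3 0 0 7 ∷
  vec 3 5 2 0 0 3 2 0 ∷
  vec 3 1 6 0 0 5 0 2 ∷
  vec 1 2 0 3 5 0 7 0 ∷
  vec 4 5 0 3 5 0 0 1 ∷
  vec 7 1 0 2 0 3 2 0 ∷
  vec 3 1 0 6 0 1 0 2 ∷
  vec 3 0 1 2 1 0 3 0 ∷
  vec 6 0 1 1 2 0 0 2 ∷
  vec 4 0 7 1 0 2 4 0 ∷
  vec 4 0 5 3 0 2 0 4 ∷
  vec 1 0 1 0 3 4 1 0 ∷
  vec 5 0 1 0 1 1 0 7 ∷
  vec 1 0 1 0 3 0 5 4 ∷
  vec 2 0 6 0 0 1 1 3 ∷
  vec 5 0 0 1 3 6 5 0 ∷
  vec 1 0 0 1 1 7 0 3 ∷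
  vec 7 0 0 3 5 0 1 2 ∷
  vec 2 0 0 6 0 5 1 3 ∷
  vec 4 0 0 0 2 3 1 1 ∷
  vec 0 2 1 1 2 0 6 0 ∷
  vec 0 1 2 1 5 0 0 1 ∷
  vec 0 4 5 3 0 2 4 0 ∷
  vec 0 4 7 1 0 2 0 4 ∷
  vec 0 3 1 0 1 1 1 0 ∷
  vec 0 3 5 0 3 2 0 3 ∷
  vec 0 7 1 0 3 0 2 1 ∷
  vec 0 2 2 0 0 3 1 7 ∷
  vec 0 3 0 5 5 3 1 0 ∷
  vec 0 1 0 3 5 4 0 1 ∷
  vec 0 1 0 3 5 0 4 5 ∷
  vec 0 2 0 2 0 3 5 3 ∷
  vec 0 4 0 0 2 7 1 1 ∷
  vec 0 0 4 0 2 1 7 3 ∷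
  vec 0 0 0 4 2 1 7 3 ∷
  []

-- An entry 4 of `w` at `j` serves every `S` containing `j` whose other elements lie among the zeros
-- of `w`, so a short list covers all pairs of an independent set and an element.
rowVectors : List (E → ℤ₈)
rowVectors =
  vec 0 0 0 0 2 4 2 6 ∷
  vec 0 0 0 0 4 0 4 4 ∷
  vec 0 0 2 2 2 4 0 0 ∷
  vec 0 0 4 4 0 0 4 4 ∷
  vec 0 0 4 4 4 0 0 0 ∷
  vec 0 1 0 6 0 1 4 1 ∷
  vec 0 1 0 6 4 1 0 5 ∷
  vec 0 1 4 2 0 1 0 5 ∷
  vec 0 2 0 4 0 2 0 2 ∷
  vec 0 2 0 4 2 6 2 0 ∷
  vec 0 2 0 4 3 0 7 3 ∷
  vec 0 2 4 0 0 2 4 6 ∷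
  vec 0 2 4 0 3 0 3 7 ∷
  vec 0 2 4 0 4 2 0 2 ∷
  vec 0 2 4 0 6 6 2 0 ∷
  vec 0 4 0 0 0 4 0 4 ∷
  vec 0 4 0 0 2 0 2 2 ∷
  vec 0 4 0 0 4 4 4 0 ∷
  vec 0 4 2 2 2 0 0 4 ∷
  vec 0 4 2 2 6 0 4 0 ∷
  vec 0 4 4 4 0 4 4 0 ∷
  vec 1 0 2 0 0 5 1 4 ∷
  vec 1 0 2 0 4 5 5 0 ∷
  vec 1 0 6 4 0 5 5 0 ∷
  vec 1 1 0 4 5 0 0 2 ∷
  vec 1 1 4 0 1 0 0 2 ∷
  vec 1 3 3 7 0 0 4 0 ∷
  vec 1 3 7 3 0 0 0 4 ∷
  vec 1 4 2 0 0 1 1 0 ∷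
  vec 1 5 0 4 3 0 6 0 ∷
  vec 1 5 4 0 7 0 6 0 ∷
  vec 1 7 7 3 0 4 0 0 ∷
  vec 2 0 0 4 0 2 6 4 ∷
  vec 2 0 0 4 2 6 0 2 ∷
  vec 2 0 0 4 3 0 5 5 ∷
  vec 2 0 0 4 4 2 2 0 ∷
  vec 2 0 4 0 0 2 2 0 ∷
  vec 2 0 4 0 3 0 1 1 ∷
  vec 2 0 4 0 6 6 0 2 ∷
  vec 2 2 0 0 2 0 0 4 ∷
  vec 2 2 0 0 6 0 4 0 ∷
  vec 2 4 0 4 0 6 6 0 ∷
  vec 2 6 0 0 2 4 0 0 ∷
  vec 4 0 0 0 0 4 4 0 ∷
  vec 4 0 0 0 2 0 6 6 ∷
  vec 4 0 0 0 4 4 0 4 ∷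
  vec 4 0 2 2 2 0 4 0 ∷
  vec 4 0 2 2 6 0 0 4 ∷
  vec 4 0 4 4 0 4 0 4 ∷
  vec 4 1 0 6 0 5 0 1 ∷
  vec 4 2 4 0 0 6 0 6 ∷
  vec 4 4 0 0 0 0 4 4 ∷
  vec 4 4 0 0 4 0 0 0 ∷
  vec 4 4 4 4 0 0 0 0 ∷
  []

-- Verification of the certificates and classification of all subsets.

relations-odd : All (OddRelation A) relations
relations-odd = from-yes (All.all? (λ α →
  (all? λ i → ∑ (λ j → α j *₈ A i j) ≟ᶠ 0₈) ×-dec any? λ j → ¬? (α j *₈ 4₈ ≟ᶠ 0₈)) relations)

relations-circuit : All (V₈-Circuit ∘ supp) relations
relations-circuit = from-yes (All.all? (V₈-Circuit? ∘ supp) relations)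

unitColumn : Fin 4 → E
unitColumn = lookup (0F ∷ 1F ∷ 2F ∷ 4F ∷ [])

-- The coefficients of a row combination are its entries in the unit columns.
rowVectors-inRowSpace : All (InRowSpace A) rowVectors
rowVectors-inRowSpace = All.map (λ {w} p → w ∘ unitColumn , p) (from-yes (All.all? (λ w →
  all? λ j → w j ≟ᶠ ∑ (λ i → w (unitColumn i) *₈ A i j)) rowVectors))

ContainsRelation : Subset 8 → Set
ContainsRelation S = Any (λ α → supp α ⊆ S) relations

-- The size bound excludes 5-element circuits and the second condition the special ones, giving
-- independence in V₈; the third gives modular independence.
CertifiedIndep : Subset 8 → Set
CertifiedIndep S =
  ∣ S ∣ ℕ.≤ 4 × (∀ D → Special4 D → ¬ (D ⊆ S)) × (∀ j → j ∈ S → Any (Separates S j) rowVectors)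

-- Each alternative settles both notions of independence at once: the first refutes both, the second
-- proves both.
classify : ∀ v → ContainsRelation (lookup v) ⊎ CertifiedIndep (lookup v)
classify = from-yes (allVec? λ v → let S = lookup v in
  Any.any? (λ α → supp α ⊆? S) relations
  ⊎-dec ((∣ S ∣ ℕ.≤? 4) ×-dec allSpecial? (λ D → ¬? (D ⊆? S))
    ×-dec all? λ j → (S j Bool.≟ true) →-dec Any.any? (separates? S j) rowVectors))

containsRelation⇒¬ModIndep : ∀ {S} → ContainsRelation S → ¬ ModIndep A S
containsRelation⇒¬ModIndep {S} r =
  let odd , supp⊆S = All.lookupAny relations-odd r
  in oddRelation⇒¬ModIndep A {S} {Any.lookup r} odd supp⊆S

-- The support of each listed relation is itself a circuit of V₈.
containsRelation⇒¬V₈-Indep : ∀ {S} → ContainsRelation S → ¬ V₈-Indep S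
containsRelation⇒¬V₈-Indep r indep =
  let circ , supp⊆S = All.lookupAny relations-circuit r
  in indep (supp (Any.lookup r)) circ supp⊆S

certified⇒ModIndep : ∀ {S} → CertifiedIndep S → ModIndep A S
certified⇒ModIndep {S} (_ , _ , sep) =
  separated⇒ModIndep A S λ j j∈S → _ , All.lookupAny rowVectors-inRowSpace (sep j j∈S)

certified⇒V₈-Indep : ∀ {S} → CertifiedIndep S → V₈-Indep S
certified⇒V₈-Indep (_ , special⊈S , _) C (inj₁ (D , special , C≗D)) C⊆S =
  special⊈S D special (⊆-trans (≗⇒⊆ (sym ∘ C≗D)) C⊆S)
certified⇒V₈-Indep (∣S∣≤4 , _) C (inj₂ (∣C∣≡5 , _)) C⊆S =
  ℕ.1+n≰n (ℕ.≤-trans (ℕ.≤-reflexive (sym ∣C∣≡5)) (ℕ.≤-trans (∣∣-mono-⊆ C⊆S) ∣S∣≤4))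

V₈-Indep⇒ModIndep : ∀ v → V₈-Indep (lookup v) → ModIndep A (lookup v)
V₈-Indep⇒ModIndep v indep =
  [ (λ r → contradiction indep (containsRelation⇒¬V₈-Indep r)) , certified⇒ModIndep ]′ (classify v)

ModIndep⇒V₈-Indep : ∀ v → ModIndep A (lookup v) → V₈-Indep (lookup v)
ModIndep⇒V₈-Indep v indep =
  [ (λ r → contradiction indep (containsRelation⇒¬ModIndep r)) , certified⇒V₈-Indep ]′ (classify v)

V₈≅M[A] : V₈≅M[ A ]
-- The columns are already in the order a to h, hence the identity. `S` agrees with
-- `lookup (tabulate S)` only pointwise, so heredity carries independence across.
V₈≅M[A] = idₚ , λ S →
  let S⊆ = ≗⇒⊆ (sym ∘ lookup∘tabulate S)
      ⊆S = ≗⇒⊆ (lookup∘tabulate S)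
      v  = tabulate S
  in mk⇔ (ModIndep-⊆ A S⊆ ∘ V₈-Indep⇒ModIndep v ∘ V₈-Indep-⊆ ⊆S)
         (V₈-Indep-⊆ S⊆ ∘ ModIndep⇒V₈-Indep v ∘ ModIndep-⊆ A ⊆S)

theorem5p9 : FreelyRepresentableV₈overℤ₈
theorem5p9 = 4 , A , A-standardForm , V₈≅M[A]
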